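{- There exists a logically minimal, non-trivial linear inference $\phi\to\psi$ that preserves neither $\land$-lccs nor $\lor$-lccs.
   Context: Fix a countably infinite set of variables. Linear formulae on a finite set $\mathcal{V}$ of variables are defined inductively: - $\top,\bot$ are linear formulae on $\emptyset$. - $x,\neg x$ are linear formulae on $\{x\}$. - If $\phi$ is on $\mathcal{V}_1$, $\psi$ is on $\mathcal{V}_2$ and $\mathcal{V}_1\cap\mathcal{V}_2=\emptyset$, then $\phi\lor\psi$ and $\phi\land\psi$ are on $\mathcal{V}_1\cup\mathcal{V}_2$. Formulae are evaluated under Boolean assignments; two formulae are logically equivalent if they are satisfied by the same assignments. A linear inference $\phi\to\psi$ is a pair of linear formulae such that every assignment satisfying $\phi$ satisfies $\psi$. An inference $\phi\to\psi$ is trivial at a variable $x$ if $\phi[\top/x]\to\psi[\bot/x]$ is valid; it is trivial if trivial at some variable, non-trivial otherwise. A linear inference $\phi\to\psi$ is logically minimal if for every linear formula $\chi$ such that $\phi\to\chi$ and $\chi\to\psi$ are both linear inferences, $\chi$ is logically equivalent to $\phi$ or to $\psi$. For a linear formula $\phi$ and distinct variables $x,y$ occurring in it, the least common connective (lcc) of $x$ and $y$ in $\phi$ is the connective ($\lor$ or $\land$) at the root of the smallest subformula of $\phi$ containing both $x$ and $y$. An inference $\phi\to\psi$ preserves $\land$-lccs if, for all distinct variables $x,y$, whenever the lcc of $x,y$ in $\phi$ is $\land$, the lcc of $x,y$ in $\psi$ is also $\land$. It preserves $\lor$-lccs if, whenever the lcc of $x,y$ in $\phi$ is $\lor$, the lcc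 of $x,y$ in $\psi$ is also $\lor$. -}

module Defs where

open import Data.Bool.Base using (Bool; true; false; not; T; _∧_; _∨_)
open import Data.List.Base using (List; []; _∷_; _++_)
open import Data.List.Membership.Propositional using (_∈_)
open import Data.List.Relation.Binary.Disjoint.Propositional using (Disjoint)
open import Data.Nat.Base using (ℕ)
open import Data.Nat.Properties using (_≟_)
open import Data.Product.Base using (_×_; ∃-syntax)
open import Data.Sum.Base using (_⊎_)
open import Function.Bundles using (_⇔_)
open import Relation.Binary.PropositionalEquality.Core using (_≢_)
open import Relation.Nullary.Decidable.Core using (yes; no)
open import Relation.Nullary.Negation.Core using (¬_)

Var : Set
Var = ℕ

data Connective : Set where
  conj disj : Connective

data Formula : Set where
  ⊤ ⊥     : Formula
  var neg : Var → Formula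
  _⟨_⟩_   : Formula → Connective → Formula → Formula

vars : Formula → List Var
vars ⊤           = []
vars ⊥           = []
vars (var x)     = x ∷ []
vars (neg x)     = x ∷ []
vars (φ ⟨ _ ⟩ ψ) = vars φ ++ vars ψ

-- The finite set a linear formula is "on" is determined by the formula, so
-- it is computed by vars rather than carried as an index.
data Linear : Formula → Set where
  ⊤   : Linear ⊤
  ⊥   : Linear ⊥
  var : ∀ x → Linear (var x)
  neg : ∀ x → Linear (neg x)
  bin : ∀ {φ ψ} c → Linear φ → Linear ψ → Disjoint (vars φ) (vars ψ) →
        Linear (φ ⟨ c ⟩ ψ)

Assignment : Set
Assignment = Var → Bool

eval : Assignment → Formula → Bool
eval ρ ⊤              = true
eval ρ ⊥              = false
eval ρ (var x)        = ρ x
eval ρ (neg x)        = not (ρ x)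
eval ρ (φ ⟨ conj ⟩ ψ) = eval ρ φ ∧ eval ρ ψ
eval ρ (φ ⟨ disj ⟩ ψ) = eval ρ φ ∨ eval ρ ψ

infix 4 _⊨_ _⇛_ _≋_ _⊑_

_⊨_ : Assignment → Formula → Set
ρ ⊨ φ = T (eval ρ φ)

_⇛_ : Formula → Formula → Set
φ ⇛ ψ = ∀ ρ → ρ ⊨ φ → ρ ⊨ ψ

_≋_ : Formula → Formula → Set
φ ≋ ψ = ∀ ρ → (ρ ⊨ φ) ⇔ (ρ ⊨ ψ)

record LinearInference (φ ψ : Formula) : Set where
  field
    linearˡ : Linear φ
    linearʳ : Linear ψ
    valid   : φ ⇛ ψ

constant : Bool → Formula
constant true  = ⊤
constant false = ⊥

-- Negation is only available on variables, so substituting a constant into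
-- the literal neg x yields the complementary constant.
_[_/_] : Formula → Bool → Var → Formula
⊤           [ b / x ] = ⊤
⊥           [ b / x ] = ⊥
(var y)     [ b / x ] with y ≟ x
... | yes _ = constant b
... | no  _ = var y
(neg y)     [ b / x ] with y ≟ x
... | yes _ = constant (not b)
... | no  _ = neg y
(φ ⟨ c ⟩ ψ) [ b / x ] = (φ [ b / x ]) ⟨ c ⟩ (ψ [ b / x ])

TrivialAt : Var → Formula → Formula → Set
TrivialAt x φ ψ = φ [ true / x ] ⇛ ψ [ false / x ]

-- Only variables of the inference count: a valid inference is trivial at
-- every variable occurring in neither of its sides.
Trivial : Formula → Formula → Set
Trivial φ ψ = ∃[ x ] (x ∈ vars φ ⊎ x ∈ vars ψ) × TrivialAt x φ ψ

NonTrivial : Formula → Formula → Set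
NonTrivial φ ψ = ¬ Trivial φ ψ

LogicallyMinimal : Formula → Formula → Set
LogicallyMinimal φ ψ =
  ∀ χ → LinearInference φ χ → LinearInference χ ψ → (χ ≋ φ) ⊎ (χ ≋ ψ)

data _⊑_ (σ : Formula) : Formula → Set where
  here  : σ ⊑ σ
  left  : ∀ {φ c ψ} → σ ⊑ φ → σ ⊑ φ ⟨ c ⟩ ψ
  right : ∀ {φ c ψ} → σ ⊑ ψ → σ ⊑ φ ⟨ c ⟩ ψ

CommonSubformula : Var → Var → Formula → Formula → Set
CommonSubformula x y φ σ = σ ⊑ φ × x ∈ vars σ × y ∈ vars σ

-- In a linear formula the subformulae containing a given variable form a
-- chain under ⊑, so "smallest" is with respect to ⊑.
SmallestCommonSubformula : Var → Var → Formula → Formula → Set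
SmallestCommonSubformula x y φ σ =
  CommonSubformula x y φ σ × (∀ τ → CommonSubformula x y φ τ → σ ⊑ τ)

-- Intended for linear φ and distinct x and y.
LccIs : Connective → Var → Var → Formula → Set
LccIs c x y φ = ∃[ α ] ∃[ β ] SmallestCommonSubformula x y φ (α ⟨ c ⟩ β)

PreservesLccs : Connective → Formula → Formula → Set
PreservesLccs c φ ψ = ∀ x y → x ≢ y → LccIs c x y φ → LccIs c x y ψ

{-# OPTIONS --safe #-}

-- The witness is
--   ((w ∧ w′) ∨ (x ∧ x′)) ∧ ((y ∧ y′) ∨ (z ∧ z′))
--     → (((w ∧ z′) ∨ x′) ∧ ((x ∧ y′) ∨ z)) ∨ (w′ ∧ y).
-- Non-triviality forces a linear interpolant χ to be equivalent to a constant-free,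
-- negation-free linear formula on exactly these eight variables: a variable that is negated,
-- missing, or switched off by setting variables foreign to the inference would make the
-- inference trivial at it. Such a formula is true at the minterms of the premise and false
-- at the maxterms of the conclusion. If it is τ ∧ υ, then τ and υ are both true where it is
-- true, and τ is false where it is false and υ has only true inputs; dually for τ ∨ υ.
-- Recursion over these conditions enumerates all possible χ, and leaves only the premise and
-- the conclusion. The pair w, y has lcc ∧ on the left and ∨ on the right, and w, x has lcc ∨
-- on the left and ∧ on the right.
module Submission where

open import Data.Bool.Base using (Bool; true; false; not; T; _∧_; _∨_)
open import Data.Bool.Properties as Bool
  using (T?; T-≡; T-∧; T-∨; ¬-not; not-involutive; ∧-comm; ∨-comm; ∧-zeroʳ; ∨-zeroʳ)
open import Data.Empty using (⊥-elim)
open import Data.Nat.Properties using (_≟_; ≤-refl; ≤-trans)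
open import Data.List.Base
  using (List; []; _∷_; _++_; length; map; filter; concatMap; cartesianProductWith)
open import Data.List.Membership.DecPropositional _≟_ using (_∈?_; _∉?_)
open import Data.List.Membership.Propositional using (_∈_; _∉_; lose)
open import Data.List.Membership.Propositional.Properties
  using (∈-++⁺ˡ; ∈-++⁺ʳ; ∈-++⁻; ∈-map⁺; ∈-concatMap⁺; ∈-cartesianProductWith⁺; ∈-filter⁺; ∈-filter⁻)
open import Data.List.Properties using (filter-notAll; filter-accept; filter-reject)
open import Data.List.Relation.Binary.Disjoint.DecPropositional _≟_
  using (Disjoint; disjoint?)
open import Data.List.Relation.Binary.Subset.Propositional using (_⊆_)
open import Data.List.Relation.Unary.All as All using (All; []; _∷_; all?)
open import Data.List.Relation.Unary.All.Properties using (all-filter; filter⁺)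
open import Data.List.Relation.Unary.Any using (Any; here; there; any?; satisfied)
open import Data.Nat.Base using (ℕ; zero; suc; _≤_; s≤s⁻¹)
open import Data.Product.Base as Product using (_×_; _,_; ∃-syntax; proj₁; proj₂)
open import Data.Sum.Base as Sum using (_⊎_; inj₁; inj₂; [_,_]′)
open import Function.Base using (_∘_; id)
open import Function.Bundles using (mk⇔; module Equivalence)
open import Relation.Binary.PropositionalEquality
  using (_≡_; _≢_; refl; sym; trans; cong; cong₂; subst; module ≡-Reasoning)
open import Relation.Nullary
  using (Dec; yes; no; does; ¬_; contradiction; ¬?; _×-dec_; _⊎-dec_; _→-dec_)
open import Relation.Nullary.Decidable using (map′; from-yes)
open import Relation.Unary using (Pred; Decidable)
open import Defs

open Equivalence using (to; from)

-- Connectives and assignments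

op : Connective → Bool → Bool → Bool
op conj = _∧_
op disj = _∨_

unit : Connective → Bool
unit conj = true
unit disj = false

op-comm : ∀ c a b → op c a b ≡ op c b a
op-comm conj = ∧-comm
op-comm disj = ∨-comm

op-identityˡ : ∀ c b → op c (unit c) b ≡ b
op-identityˡ conj b = refl
op-identityˡ disj b = refl

op-zeroˡ : ∀ c b → op c (not (unit c)) b ≡ not (unit c)
op-zeroˡ conj b = refl
op-zeroˡ disj b = refl

op-idem : ∀ c b → op c b b ≡ b
op-idem conj = Bool.∧-idem
op-idem disj = Bool.∨-idem

op-unit⁻ : ∀ c {a b} → op c a b ≡ unit c → a ≡ unit c × b ≡ unit c
op-unit⁻ conj {true}  eq = refl , eq
op-unit⁻ disj {false} eq = refl , eq

op-zero⁻ : ∀ c {a b} → op c a b ≡ not (unit c) → a ≡ not (unit c) ⊎ b ≡ not (unit c)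
op-zero⁻ conj {true}  eq = inj₂ eq
op-zero⁻ conj {false} eq = inj₁ eq
op-zero⁻ disj {true}  eq = inj₁ eq
op-zero⁻ disj {false} eq = inj₂ eq

-- For `b = true` this is monotonicity, for `b = false` its contrapositive; keeping `b` as a
-- parameter serves both values at once. If `b` is the unit of `c`, both arguments equal `b`;
-- otherwise one of them does, and it absorbs the other.
op-mono : ∀ c b {a a′ d d′} → (a ≡ b → a′ ≡ b) → (d ≡ b → d′ ≡ b) → op c a d ≡ b → op c a′ d′ ≡ b
op-mono conj true  {true}  {d = true}  f g eq = cong₂ _∧_ (f refl) (g refl)
op-mono conj false {false} {d′ = d′}   f g eq = cong (_∧ d′) (f refl)
op-mono conj false {true} {a′} {false} f g eq = trans (cong (a′ ∧_) (g refl)) (∧-zeroʳ a′)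
op-mono disj true  {true}  {d′ = d′}   f g eq = cong (_∨ d′) (f refl)
op-mono disj true  {false} {a′} {true} f g eq = trans (cong (a′ ∨_) (g refl)) (∨-zeroʳ a′)
op-mono disj false {false} {d = false} f g eq = cong₂ _∨_ (f refl) (g refl)

eval-op : ∀ ρ φ c ψ → eval ρ (φ ⟨ c ⟩ ψ) ≡ op c (eval ρ φ) (eval ρ ψ)
eval-op ρ φ conj ψ = refl
eval-op ρ φ disj ψ = refl

infix 4 _≈_

_≈_ : Formula → Formula → Set
φ ≈ ψ = ∀ ρ → eval ρ φ ≡ eval ρ ψ

≈⇒≋ : ∀ φ ψ → φ ≈ ψ → φ ≋ ψ
≈⇒≋ φ ψ φ≈ψ ρ = mk⇔ (subst T (φ≈ψ ρ)) (subst T (sym (φ≈ψ ρ)))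

⟨⟩-cong : ∀ c {φ φ′ ψ ψ′} → φ ≈ φ′ → ψ ≈ ψ′ → φ ⟨ c ⟩ ψ ≈ φ′ ⟨ c ⟩ ψ′
⟨⟩-cong c {φ} {φ′} {ψ} {ψ′} φ≈φ′ ψ≈ψ′ ρ = begin
  eval ρ (φ ⟨ c ⟩ ψ)            ≡⟨ eval-op ρ φ c ψ ⟩
  op c (eval ρ φ) (eval ρ ψ)    ≡⟨ cong₂ (op c) (φ≈φ′ ρ) (ψ≈ψ′ ρ) ⟩
  op c (eval ρ φ′) (eval ρ ψ′)  ≡⟨ eval-op ρ φ′ c ψ′ ⟨
  eval ρ (φ′ ⟨ c ⟩ ψ′)          ∎
  where open ≡-Reasoning

⟨⟩-comm : ∀ c φ ψ → φ ⟨ c ⟩ ψ ≈ ψ ⟨ c ⟩ φ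
⟨⟩-comm c φ ψ ρ =
  trans (eval-op ρ φ c ψ) (trans (op-comm c (eval ρ φ) (eval ρ ψ)) (sym (eval-op ρ ψ c φ)))

eval-absorb : ∀ c φ ψ ρ → eval ρ φ ≡ not (unit c) → eval ρ (φ ⟨ c ⟩ ψ) ≡ not (unit c)
eval-absorb c φ ψ ρ eq =
  trans (eval-op ρ φ c ψ) (trans (cong (λ a → op c a (eval ρ ψ)) eq) (op-zeroˡ c (eval ρ ψ)))

infixl 6 _[_≔_]

_[_≔_] : Assignment → Var → Bool → Assignment
(ρ [ x ≔ b ]) y with y ≟ x
... | yes _ = b
... | no  _ = ρ y

≔-same : ∀ ρ x b → (ρ [ x ≔ b ]) x ≡ b
≔-same ρ x b with x ≟ x
... | yes _  = refl
... | no x≢x = contradiction refl x≢x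

≔-other : ∀ ρ {x y} b → y ≢ x → (ρ [ x ≔ b ]) y ≡ ρ y
≔-other ρ {x} {y} b y≢x with y ≟ x
... | yes y≡x = contradiction y≡x y≢x
... | no _    = refl

eval-constant : ∀ ρ b → eval ρ (constant b) ≡ b
eval-constant ρ true  = refl
eval-constant ρ false = refl

eval-subst : ∀ ρ φ b x → eval ρ (φ [ b / x ]) ≡ eval (ρ [ x ≔ b ]) φ
eval-subst ρ ⊤ b x = refl
eval-subst ρ ⊥ b x = refl
eval-subst ρ (var y) b x with y ≟ x
... | yes _ = eval-constant ρ b
... | no  _ = refl
eval-subst ρ (neg y) b x with y ≟ x
... | yes _ = eval-constant ρ (not b)
... | no  _ = refl
eval-subst ρ (φ ⟨ conj ⟩ ψ) b x = cong₂ _∧_ (eval-subst ρ φ b x) (eval-subst ρ ψ b x)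
eval-subst ρ (φ ⟨ disj ⟩ ψ) b x = cong₂ _∨_ (eval-subst ρ φ b x) (eval-subst ρ ψ b x)

eval-local : ∀ {ρ σ} φ → (∀ {x} → x ∈ vars φ → ρ x ≡ σ x) → eval ρ φ ≡ eval σ φ
eval-local ⊤ ρ≗σ = refl
eval-local ⊥ ρ≗σ = refl
eval-local (var x) ρ≗σ = ρ≗σ (here refl)
eval-local (neg x) ρ≗σ = cong not (ρ≗σ (here refl))
eval-local {ρ} {σ} (φ ⟨ c ⟩ ψ) ρ≗σ = begin
  eval ρ (φ ⟨ c ⟩ ψ)          ≡⟨ eval-op ρ φ c ψ ⟩
  op c (eval ρ φ) (eval ρ ψ)  ≡⟨ cong₂ (op c) (eval-local φ (ρ≗σ ∘ ∈-++⁺ˡ))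
                                              (eval-local ψ (ρ≗σ ∘ ∈-++⁺ʳ (vars φ))) ⟩
  op c (eval σ φ) (eval σ ψ)  ≡⟨ eval-op σ φ c ψ ⟨
  eval σ (φ ⟨ c ⟩ ψ)          ∎
  where open ≡-Reasoning

eval-≔-fresh : ∀ ρ {x} b φ → x ∉ vars φ → eval (ρ [ x ≔ b ]) φ ≡ eval ρ φ
eval-≔-fresh ρ b φ x∉φ = eval-local φ λ { y∈φ → ≔-other ρ b λ { refl → x∉φ y∈φ } }

override : List Var → Assignment → Assignment → Assignment
override V ρ σ x with x ∈? V
... | yes _ = ρ x
... | no  _ = σ x

override-∈ : ∀ V {ρ σ x} → x ∈ V → override V ρ σ x ≡ ρ x
override-∈ V {x = x} x∈V with x ∈? V
... | yes _   = refl
... | no  x∉V = contradiction x∈V x∉V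

override-∉ : ∀ V {ρ σ x} → x ∉ V → override V ρ σ x ≡ σ x
override-∉ V {x = x} x∉V with x ∈? V
... | yes x∈V = contradiction x∈V x∉V
... | no  _   = refl

-- Positive formulae

-- Constants are excluded along with negations, so that a positive formula always has a variable and
-- takes the value `b` when all its variables do.
data Positive : Formula → Set where
  var : ∀ x → Positive (var x)
  bin : ∀ {φ ψ} c → Positive φ → Positive ψ → Positive (φ ⟨ c ⟩ ψ)

occurring : ∀ {φ} → Positive φ → ∃[ x ] x ∈ vars φ
occurring (var x)     = x , here refl
occurring (bin _ p _) = Product.map₂ ∈-++⁺ˡ (occurring p)

record TreeOver (V : List Var) (τ : Formula) : Set where
  field
    positive : Positive τ
    linear   : Linear τ
    vars⊆    : vars τ ⊆ V
    ⊆vars    : V ⊆ vars τ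

eval-uniform : ∀ {φ ρ b} → Positive φ → (∀ {x} → x ∈ vars φ → ρ x ≡ b) → eval ρ φ ≡ b
eval-uniform (var x) eq = eq (here refl)
eval-uniform {φ ⟨ _ ⟩ ψ} {ρ} {b} (bin c p q) eq = begin
  eval ρ (φ ⟨ c ⟩ ψ)          ≡⟨ eval-op ρ φ c ψ ⟩
  op c (eval ρ φ) (eval ρ ψ)  ≡⟨ cong₂ (op c) (eval-uniform p (eq ∘ ∈-++⁺ˡ))
                                              (eval-uniform q (eq ∘ ∈-++⁺ʳ (vars φ))) ⟩
  op c b b                    ≡⟨ op-idem c b ⟩
  b                           ∎
  where open ≡-Reasoning

-- For b = false the hypothesis orders σ below ρ.
eval-mono : ∀ {φ ρ σ} b → Positive φ → (∀ {x} → x ∈ vars φ → ρ x ≡ b → σ x ≡ b) →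
            eval ρ φ ≡ b → eval σ φ ≡ b
eval-mono b (var x) ρ≤σ = ρ≤σ (here refl)
eval-mono {φ ⟨ _ ⟩ ψ} {ρ} {σ} b (bin c p q) ρ≤σ eq =
  trans (eval-op σ φ c ψ)
        (op-mono c b (eval-mono b p (ρ≤σ ∘ ∈-++⁺ˡ)) (eval-mono b q (ρ≤σ ∘ ∈-++⁺ʳ (vars φ)))
                 (trans (sym (eval-op ρ φ c ψ)) eq))

-- Shapes of linear formulae relative to a set of variables

module _ (V : List Var) where

  -- Only variables of `φ` are pinned, so pins for operands with disjoint variables can be merged
  -- into one assignment.
  Pinned : Formula → Assignment → Assignment → Set
  Pinned φ o ρ = ∀ {y} → y ∈ vars φ → y ∉ V → ρ y ≡ o y

  -- For some values of the variables outside V, φ is not properly increasing in x.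
  Insensitive : Var → Formula → Set
  Insensitive x φ = ∃[ o ] (∀ ρ → Pinned φ o ρ → ρ x ≡ true →
                            eval ρ φ ≡ true → eval (ρ [ x ≔ false ]) φ ≡ true)

  -- A `free` formula can be forced to either value by variables outside `V` alone; both values are
  -- offered because the absorbing one depends on the connective above. In `insensitive`, `x` must
  -- occur in `φ`, which keeps it out of any operand disjoint from `φ`.
  data Shape (φ : Formula) : Set where
    fixed       : ∀ b → (∀ ρ → eval ρ φ ≡ b) → Shape φ
    free        : (∀ b → ∃[ o ] (∀ ρ → Pinned φ o ρ → eval ρ φ ≡ b)) → Shape φ
    insensitive : ∀ x → x ∈ V → x ∈ vars φ → Insensitive x φ → Shape φ
    tree        : ∀ τ → Positive τ → Linear τ → vars τ ⊆ V → vars τ ⊆ vars φ → φ ≈ τ → Shape φ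

  transport : ∀ {φ ψ} → vars φ ⊆ vars ψ → ψ ≈ φ → Shape φ → Shape ψ
  transport φ⊆ψ ψ≈φ (fixed b eq) = fixed b λ ρ → trans (ψ≈φ ρ) (eq ρ)
  transport φ⊆ψ ψ≈φ (free pins) = free λ b → let o , pin = pins b in
    o , λ ρ pinned → trans (ψ≈φ ρ) (pin ρ (pinned ∘ φ⊆ψ))
  transport φ⊆ψ ψ≈φ (insensitive x x∈V x∈φ (o , ins)) = insensitive x x∈V (φ⊆ψ x∈φ)
    (o , λ ρ pinned ρx eq →
      trans (ψ≈φ (ρ [ x ≔ false ])) (ins ρ (pinned ∘ φ⊆ψ) ρx (trans (sym (ψ≈φ ρ)) eq)))
  transport φ⊆ψ ψ≈φ (tree τ p l τ⊆V τ⊆φ φ≈τ) =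
    tree τ p l τ⊆V (φ⊆ψ ∘ τ⊆φ) λ ρ → trans (ψ≈φ ρ) (φ≈τ ρ)

  flip : ∀ c {φ ψ} → Shape (ψ ⟨ c ⟩ φ) → Shape (φ ⟨ c ⟩ ψ)
  flip c {φ} {ψ} =
    transport (λ x∈ → [ ∈-++⁺ʳ (vars φ) , ∈-++⁺ˡ ]′ (∈-++⁻ (vars ψ) x∈)) (⟨⟩-comm c φ ψ)

  -- A constant operand equal to the unit of `c` disappears; the other constant absorbs `ψ`.
  shape-fixed : ∀ c {φ ψ} b → (∀ ρ → eval ρ φ ≡ b) → Shape ψ → Shape (φ ⟨ c ⟩ ψ)
  shape-fixed c {φ} {ψ} b eq s with b Bool.≟ unit c
  ... | yes refl = transport (∈-++⁺ʳ (vars φ)) (λ ρ → begin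
          eval ρ (φ ⟨ c ⟩ ψ)          ≡⟨ eval-op ρ φ c ψ ⟩
          op c (eval ρ φ) (eval ρ ψ)  ≡⟨ cong (λ a → op c a (eval ρ ψ)) (eq ρ) ⟩
          op c (unit c) (eval ρ ψ)    ≡⟨ op-identityˡ c _ ⟩
          eval ρ ψ                    ∎) s
        where open ≡-Reasoning
  ... | no b≢unit = fixed (not (unit c)) λ ρ →
          eval-absorb c φ ψ ρ (trans (eq ρ) (¬-not b≢unit))

  -- By disjointness `x` does not occur in `ψ`, so switching it off affects only `φ`, and
  -- monotonicity of the connective preserves truth.
  shape-insensitive : ∀ c {φ ψ} x → Disjoint (vars φ) (vars ψ) →
                      x ∈ V → x ∈ vars φ → Insensitive x φ → Shape (φ ⟨ c ⟩ ψ)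
  shape-insensitive c {φ} {ψ} x φ#ψ x∈V x∈φ (o , ins) =
    insensitive x x∈V (∈-++⁺ˡ x∈φ) (o , λ ρ pinned ρx eq →
      trans (eval-op (ρ [ x ≔ false ]) φ c ψ)
            (op-mono c true (ins ρ (pinned ∘ ∈-++⁺ˡ) ρx)
                     (trans (eval-≔-fresh ρ false ψ (λ x∈ψ → φ#ψ (x∈φ , x∈ψ))))
                     (trans (sym (eval-op ρ φ c ψ)) eq)))

  -- Pinning φ to the absorbing value of c makes φ ⟨ c ⟩ ψ ignore the variables of ψ.
  shape-free-tree : ∀ c {φ ψ τ} → (∀ b → ∃[ o ] (∀ ρ → Pinned φ o ρ → eval ρ φ ≡ b)) →
                    Positive τ → vars τ ⊆ V → vars τ ⊆ vars ψ → Shape (φ ⟨ c ⟩ ψ)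
  shape-free-tree c {φ} {ψ} pins p τ⊆V τ⊆ψ =
    let x , x∈τ = occurring p
        o , pin = pins (not (unit c)) in
    insensitive x (τ⊆V x∈τ) (∈-++⁺ʳ (vars φ) (τ⊆ψ x∈τ)) (o , λ ρ pinned _ eq → begin
      eval (ρ [ x ≔ false ]) (φ ⟨ c ⟩ ψ)
        ≡⟨ eval-absorb c φ ψ _ (pin _ λ y∈φ y∉V →
             trans (≔-other ρ false λ { refl → y∉V (τ⊆V x∈τ) }) (pinned (∈-++⁺ˡ y∈φ) y∉V)) ⟩
      not (unit c)
        ≡⟨ eval-absorb c φ ψ ρ (pin ρ (pinned ∘ ∈-++⁺ˡ)) ⟨
      eval ρ (φ ⟨ c ⟩ ψ)
        ≡⟨ eq ⟩
      true ∎)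
    where open ≡-Reasoning

  -- Both operands are pinned to the same `b`, and the connective is idempotent.
  shape-free : ∀ c {φ ψ} → Disjoint (vars φ) (vars ψ) →
               (∀ b → ∃[ o ] (∀ ρ → Pinned φ o ρ → eval ρ φ ≡ b)) →
               (∀ b → ∃[ o ] (∀ ρ → Pinned ψ o ρ → eval ρ ψ ≡ b)) → Shape (φ ⟨ c ⟩ ψ)
  shape-free c {φ} {ψ} φ#ψ pinsφ pinsψ = free λ b →
    let oφ , pinφ = pinsφ b
        oψ , pinψ = pinsψ b in
    merge oφ oψ , λ ρ pinned → begin
      eval ρ (φ ⟨ c ⟩ ψ)
        ≡⟨ eval-op ρ φ c ψ ⟩
      op c (eval ρ φ) (eval ρ ψ)
        ≡⟨ cong₂ (op c)
             (pinφ ρ λ y∈φ y∉V → trans (pinned (∈-++⁺ˡ y∈φ) y∉V) (mergeˡ oφ oψ y∈φ))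
             (pinψ ρ λ y∈ψ y∉V → trans (pinned (∈-++⁺ʳ (vars φ) y∈ψ) y∉V) (mergeʳ oφ oψ y∈ψ)) ⟩
      op c b b
        ≡⟨ op-idem c b ⟩
      b ∎
    where
    open ≡-Reasoning
    merge : Assignment → Assignment → Assignment
    merge = override (vars φ)
    mergeˡ : ∀ ρ σ {y} → y ∈ vars φ → merge ρ σ y ≡ ρ y
    mergeˡ ρ σ = override-∈ (vars φ)
    mergeʳ : ∀ ρ σ {y} → y ∈ vars ψ → merge ρ σ y ≡ σ y
    mergeʳ ρ σ y∈ψ = override-∉ (vars φ) λ y∈φ → φ#ψ (y∈φ , y∈ψ)

  shape-bin : ∀ c {φ ψ} → Disjoint (vars φ) (vars ψ) → Shape φ → Shape ψ → Shape (φ ⟨ c ⟩ ψ)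
  shape-bin c φ#ψ (fixed b eq) s = shape-fixed c b eq s
  shape-bin c φ#ψ s (fixed b eq) = flip c (shape-fixed c b eq s)
  shape-bin c φ#ψ (insensitive x x∈V x∈φ ins) _ = shape-insensitive c x φ#ψ x∈V x∈φ ins
  shape-bin c φ#ψ _ (insensitive x x∈V x∈ψ ins) =
    flip c (shape-insensitive c x (φ#ψ ∘ Product.swap) x∈V x∈ψ ins)
  shape-bin c φ#ψ (free pinsφ) (free pinsψ) = shape-free c φ#ψ pinsφ pinsψ
  shape-bin c φ#ψ (free pins) (tree τ p _ τ⊆V τ⊆ψ _) = shape-free-tree c pins p τ⊆V τ⊆ψ
  shape-bin c φ#ψ (tree τ p _ τ⊆V τ⊆φ _) (free pins) = flip c (shape-free-tree c pins p τ⊆V τ⊆φ)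
  shape-bin c {φ} {ψ} φ#ψ (tree τ p l τ⊆V τ⊆φ φ≈τ) (tree υ q m υ⊆V υ⊆ψ ψ≈υ) =
    tree (τ ⟨ c ⟩ υ) (bin c p q) (bin c l m λ (x∈τ , x∈υ) → φ#ψ (τ⊆φ x∈τ , υ⊆ψ x∈υ))
      ([ τ⊆V , υ⊆V ]′ ∘ ∈-++⁻ (vars τ))
      ([ ∈-++⁺ˡ ∘ τ⊆φ , ∈-++⁺ʳ (vars φ) ∘ υ⊆ψ ]′ ∘ ∈-++⁻ (vars τ))
      (⟨⟩-cong c φ≈τ ψ≈υ)

  shape : ∀ {φ} → Linear φ → Shape φ
  shape ⊤ = fixed true λ _ → refl
  shape ⊥ = fixed false λ _ → refl
  shape (var x) with x ∈? V
  ... | yes x∈V = tree (var x) (var x) (var x) (λ { (here refl) → x∈V }) id λ _ → refl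
  ... | no  x∉V = free λ b → (λ _ → b) , λ ρ pinned → pinned (here refl) x∉V
  shape (neg x) with x ∈? V
  -- Switching `x` off makes the literal true, whatever it was before.
  ... | yes x∈V = insensitive x x∈V (here refl)
          ((λ _ → true) , λ ρ _ _ _ → cong not (≔-same ρ x false))
  ... | no  x∉V = free λ b → (λ _ → not b) , λ ρ pinned →
          trans (cong not (pinned (here refl) x∉V)) (not-involutive b)
  shape (bin c l m φ#ψ) = shape-bin c φ#ψ (shape l) (shape m)

  -- Interpolants of a non-trivial inference

  -- If `χ` were insensitive to some `x` in `V`, truth of `φ` with `x` on would pass to `χ`, survive
  -- switching `x` off, and pass to `ψ`: the inference would be trivial at `x`. The shapes `fixed`
  -- and `free` are insensitive to every variable of `V`, hence to `x₀`.
  interpolant-tree :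
    ∀ φ ψ χ {x₀} → x₀ ∈ V → vars φ ⊆ V → vars ψ ⊆ V → (∀ {x} → x ∈ V → ¬ TrivialAt x φ ψ) →
    Linear χ → φ ⇛ χ → χ ⇛ ψ →
    ∃[ τ ] (TreeOver V τ × χ ≈ τ)
  interpolant-tree φ ψ χ {x₀} x₀∈V φ⊆V ψ⊆V nontrivial l φ⇛χ χ⇛ψ = go (shape l)
    where
    open ≡-Reasoning

    sensitive : ∀ {x} → x ∈ V → ¬ Insensitive x χ
    sensitive {x} x∈V (o , ins) = nontrivial x∈V λ ρ ρ⊨φ →
      -- Outside `V` the pinned values can be imposed freely, since neither `φ` nor `ψ` has
      -- variables there.
      let σ = override V (ρ [ x ≔ true ]) o
          σ≗ρ : ∀ {y} → y ∈ V → σ y ≡ (ρ [ x ≔ true ]) y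
          σ≗ρ = override-∈ V
          σ⊨φ : eval σ φ ≡ true
          σ⊨φ = begin
            eval σ φ                   ≡⟨ eval-local φ (σ≗ρ ∘ φ⊆V) ⟩
            eval (ρ [ x ≔ true ]) φ    ≡⟨ eval-subst ρ φ true x ⟨
            eval ρ (φ [ true / x ])    ≡⟨ to T-≡ ρ⊨φ ⟩
            true                       ∎
          σ⊨χ = ins σ (λ _ → override-∉ V) (trans (σ≗ρ x∈V) (≔-same ρ x true))
                    (to T-≡ (φ⇛χ σ (from T-≡ σ⊨φ)))
          σ⊨ψ = χ⇛ψ (σ [ x ≔ false ]) (from T-≡ σ⊨χ)
      in from T-≡ (begin
            eval ρ (ψ [ false / x ])   ≡⟨ eval-subst ρ ψ false x ⟩
            eval (ρ [ x ≔ false ]) ψ   ≡⟨ eval-local ψ (λ y∈ψ → ≔-cong ρ σ (σ≗ρ (ψ⊆V y∈ψ))) ⟩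
            eval (σ [ x ≔ false ]) ψ   ≡⟨ to T-≡ σ⊨ψ ⟩
            true                       ∎)
      where
      ≔-cong : ∀ ρ σ {y} → σ y ≡ (ρ [ x ≔ true ]) y → (ρ [ x ≔ false ]) y ≡ (σ [ x ≔ false ]) y
      ≔-cong ρ σ {y} eq with y ≟ x
      ... | yes _ = refl
      ... | no  _ = sym eq

    go : Shape χ → ∃[ τ ] (TreeOver V τ × χ ≈ τ)
    go (fixed b eq) = ⊥-elim (sensitive x₀∈V
      ((λ _ → true) , λ ρ _ _ ρ⊨χ → trans (eq _) (trans (sym (eq ρ)) ρ⊨χ)))
    go (free pins) = let o , pin = pins true in ⊥-elim (sensitive x₀∈V
      (o , λ ρ pinned _ _ → pin _ λ y∈χ y∉V →
        trans (≔-other ρ false λ { refl → y∉V x₀∈V }) (pinned y∈χ y∉V)))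
    go (insensitive x x∈V _ ins) = ⊥-elim (sensitive x∈V ins)
    go (tree τ p lτ τ⊆V _ χ≈τ) =
      τ , record { positive = p ; linear = lτ ; vars⊆ = τ⊆V ; ⊆vars = V⊆τ } , χ≈τ
      where
      V⊆τ : V ⊆ vars τ
      V⊆τ {x} x∈V with x ∈? vars τ
      ... | yes x∈τ = x∈τ
      -- A variable absent from `τ` cannot influence `χ`, so switching it off is harmless.
      ... | no  x∉τ = ⊥-elim (sensitive x∈V ((λ _ → true) , λ ρ _ _ ρ⊨χ → begin
        eval (ρ [ x ≔ false ]) χ  ≡⟨ χ≈τ _ ⟩
        eval (ρ [ x ≔ false ]) τ  ≡⟨ eval-≔-fresh ρ false τ x∉τ ⟩
        eval ρ τ                  ≡⟨ χ≈τ ρ ⟨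
        eval ρ χ                  ≡⟨ ρ⊨χ ⟩
        true                      ∎))

-- Enumeration of trees separating two sets of assignments

splits : List Var → List (List Var × List Var)
splits []      = ([] , []) ∷ []
splits (x ∷ V) = map (Product.map₁ (x ∷_)) (splits V) ++ map (Product.map₂ (x ∷_)) (splits V)

filter∈splits : ∀ {p} {P : Pred Var p} (P? : Decidable P) V →
                (filter P? V , filter (¬? ∘ P?) V) ∈ splits V
filter∈splits P? [] = here refl
filter∈splits P? (x ∷ V) with P? x
... | yes _ = ∈-++⁺ˡ (∈-map⁺ (Product.map₁ (x ∷_)) (filter∈splits P? V))
... | no  _ = ∈-++⁺ʳ (map (Product.map₁ (x ∷_)) (splits V))
                     (∈-map⁺ (Product.map₂ (x ∷_)) (filter∈splits P? V))

record Sample : Set where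
  constructor sample
  field
    positives negatives : List Assignment

open Sample

at : Bool → Sample → List Assignment
at true  = positives
at false = negatives

record Separates (S : Sample) (τ : Formula) : Set where
  constructor separating
  field
    onPositives : All (λ ρ → eval ρ τ ≡ true) (positives S)
    onNegatives : All (λ ρ → eval ρ τ ≡ false) (negatives S)

separates? : ∀ S → Decidable (Separates S)
separates? S τ = map′ (λ (p , n) → separating p n) (λ (separating p n) → p , n)
  (all? (λ ρ → eval ρ τ Bool.≟ true) (positives S) ×-dec
   all? (λ ρ → eval ρ τ Bool.≟ false) (negatives S))

separates-at : ∀ {S τ} → Separates S τ → ∀ b → All (λ ρ → eval ρ τ ≡ b) (at b S)
separates-at (separating p n) true  = p
separates-at (separating p n) false = n

separates-cong : ∀ {S τ υ} → τ ≈ υ → Separates S τ → Separates S υ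
separates-cong τ≈υ (separating p n) =
  separating (All.map (λ {ρ} → trans (sym (τ≈υ ρ))) p) (All.map (λ {ρ} → trans (sym (τ≈υ ρ))) n)

Constant : Bool → List Var → Pred Assignment _
Constant b V ρ = All (λ x → ρ x ≡ b) V

constant? : ∀ b V → Decidable (Constant b V)
constant? b V ρ = all? (λ x → ρ x Bool.≟ b) V

-- If τ ⟨ c ⟩ υ separates S, with υ a tree over V, then τ separates restrict c V S: at an
-- assignment making υ neutral for c, the value of τ ⟨ c ⟩ υ is that of τ.
restrict : Connective → List Var → Sample → Sample
restrict conj V (sample P N) = sample P (filter (constant? true V) N)
restrict disj V (sample P N) = sample (filter (constant? false V) P) N

-- On `V`, this is the pointwise order from `ρ` to `σ` when `b = true` and the reverse order when
-- `b = false`, in the form that `eval-mono` takes.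
Below : Bool → List Var → Assignment → Assignment → Set
Below b V ρ σ = All (λ x → ρ x ≡ b → σ x ≡ b) V

below? : ∀ b V ρ σ → Dec (Below b V ρ σ)
below? b V ρ σ = all? (λ x → (ρ x Bool.≟ b) →-dec (σ x Bool.≟ b)) V

-- No sample point at which the operand over `V` must take the unit value may force, by
-- monotonicity, that same value at `σ`.
Absorbable : Connective → List Var → Sample → Assignment → Set
Absorbable c V S σ = All (λ ρ → ¬ Below (unit c) V ρ σ) (at (unit c) S)

-- Necessary for some τ ⟨ c ⟩ υ to separate S, with τ over V and υ over W: where it
-- takes the absorbing value of c, so does τ or υ.
Splittable : Connective → Sample → Pred (List Var × List Var) _
Splittable c S (V , W) =
  All (λ σ → Absorbable c V S σ ⊎ Absorbable c W S σ) (at (not (unit c)) S)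

splittable? : ∀ c S → Decidable (Splittable c S)
splittable? c S (V , W) = all? (λ σ → absorbable? V σ ⊎-dec absorbable? W σ) (at (not (unit c)) S)
  where
  absorbable? : ∀ V σ → Dec (Absorbable c V S σ)
  absorbable? V σ = all? (λ ρ → ¬? (below? (unit c) V ρ σ)) (at (unit c) S)

separates-units : ∀ {c S τ υ} → Separates S (τ ⟨ c ⟩ υ) →
                  All (λ ρ → eval ρ τ ≡ unit c × eval ρ υ ≡ unit c) (at (unit c) S)
separates-units {c} {τ = τ} {υ} sep =
  All.map (λ {ρ} eq → op-unit⁻ c (trans (sym (eval-op ρ τ c υ)) eq)) (separates-at sep (unit c))

separates-restrict : ∀ c {V S τ υ} → Positive υ → vars υ ⊆ V →
                     Separates S (τ ⟨ c ⟩ υ) → Separates (restrict c V S) τ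
separates-restrict c {V} {S} {τ} {υ} p υ⊆V sep = go c sep
  where
  neutral : ∀ c {b ρ} → Constant (unit c) V ρ → eval ρ (τ ⟨ c ⟩ υ) ≡ b → eval ρ τ ≡ b
  neutral c {b} {ρ} const eq = begin
    eval ρ τ                    ≡⟨ op-identityˡ c _ ⟨
    op c (unit c) (eval ρ τ)    ≡⟨ op-comm c (unit c) _ ⟩
    op c (eval ρ τ) (unit c)    ≡⟨ cong (op c (eval ρ τ)) (eval-uniform p (All.lookup const ∘ υ⊆V)) ⟨
    op c (eval ρ τ) (eval ρ υ)  ≡⟨ eval-op ρ τ c υ ⟨
    eval ρ (τ ⟨ c ⟩ υ)          ≡⟨ eq ⟩
    b                           ∎
    where open ≡-Reasoning

  neutrals : ∀ c {b} Σ → All (λ ρ → eval ρ (τ ⟨ c ⟩ υ) ≡ b) Σ →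
             All (λ ρ → eval ρ τ ≡ b) (filter (constant? (unit c) V) Σ)
  neutrals c Σ eqs = All.map (λ (const , eq) → neutral c const eq)
    (All.zip (all-filter (constant? (unit c) V) Σ , filter⁺ (constant? (unit c) V) eqs))

  go : ∀ c → Separates S (τ ⟨ c ⟩ υ) → Separates (restrict c V S) τ
  go conj sep = separating (All.map proj₁ (separates-units sep)) (neutrals conj _ (Separates.onNegatives sep))
  go disj sep = separating (neutrals disj _ (Separates.onPositives sep)) (All.map proj₁ (separates-units sep))

absorbable : ∀ c {V S τ σ} → Positive τ → vars τ ⊆ V →
             All (λ ρ → eval ρ τ ≡ unit c) (at (unit c) S) →
             eval σ τ ≡ not (unit c) → Absorbable c V S σ
absorbable c p τ⊆V units eq = All.map
  (λ unitρ ρ≤σ → Bool.not-¬ (eval-mono (unit c) p (All.lookup ρ≤σ ∘ τ⊆V) unitρ) eq) units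

splittable : ∀ c {V W S τ υ} → Positive τ → vars τ ⊆ V → Positive υ → vars υ ⊆ W →
             Separates S (τ ⟨ c ⟩ υ) → Splittable c S (V , W)
splittable c {τ = τ} {υ} p τ⊆V q υ⊆W sep = All.map
  (λ {σ} eq → Sum.map
    (absorbable c p τ⊆V (All.map proj₁ (separates-units sep)))
    (absorbable c q υ⊆W (All.map proj₂ (separates-units sep)))
    (op-zero⁻ c (trans (sym (eval-op σ τ c υ)) eq)))
  (separates-at sep (not (unit c)))

-- The trees over V separating S up to equivalence, provided the fuel is at least the
-- length of V. By commutativity the first variable of V may be put in the left subtree.
candidates : ℕ → List Var → Sample → List Formula
candidates zero    V       S = []
candidates (suc k) []      S = []
candidates (suc k) (x ∷ V) S =
  -- Restriction and splittability are only necessary conditions, so the compounds are tested again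
  -- on the full sample.
  filter (separates? S) (var x ∷ compounds conj ++ compounds disj)
  module Candidates where
  combine : Connective → List Var × List Var → List Formula
  -- A split with empty `W` contributes nothing, since there are no candidates over the empty list.
  combine c (V , W) = cartesianProductWith (λ υ τ → τ ⟨ c ⟩ υ)
    (candidates k W (restrict c V S)) (candidates k V (restrict c W S))

  compounds : Connective → List Formula
  compounds c = concatMap (combine c)
    (filter (splittable? c S) (map (Product.map₁ (x ∷_)) (splits V)))

open TreeOver

-- Induction on the fuel. A compound tree splits the list by occurrence in its left operand; both
-- parts are strictly shorter, so one unit less of fuel suffices for each.
candidates-complete : ∀ k V S τ → length V ≤ k → TreeOver V τ → Separates S τ →
                      ∃[ υ ] (υ ∈ candidates k V S × τ ≈ υ)
-- A positive formula has a variable, so there is no tree over the empty list.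
candidates-complete zero [] S τ _ over sep with () ← vars⊆ over (proj₂ (occurring (positive over)))
candidates-complete (suc k) [] S τ _ over sep with () ← vars⊆ over (proj₂ (occurring (positive over)))
candidates-complete (suc k) (x ∷ V) S (var y) _ over sep with ⊆vars over (here refl)
... | here refl = var x , ∈-filter⁺ (separates? S) (here refl) sep , λ _ → refl
candidates-complete (suc k) (x ∷ V) S (τ ⟨ c ⟩ υ) V≤k over sep
  with record { positive = bin _ p q ; linear = bin _ l m τ#υ } ← over
  = [ (λ x∈τ → complete τ υ p q l m τ#υ x∈τ (vars⊆ over) (⊆vars over) sep)
    -- When the first variable lies in the right operand, the mirrored formula is treated instead.
    , (λ x∈υ → Product.map₂ (Product.map₂ λ eq ρ → trans (⟨⟩-comm c τ υ ρ) (eq ρ))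
        (complete υ τ q p m l (τ#υ ∘ Product.swap) x∈υ
          ([ vars⊆ over ∘ ∈-++⁺ʳ (vars τ) , vars⊆ over ∘ ∈-++⁺ˡ ]′ ∘ ∈-++⁻ (vars υ))
          ([ ∈-++⁺ʳ (vars υ) , ∈-++⁺ˡ ]′ ∘ ∈-++⁻ (vars τ) ∘ ⊆vars over)
          (separates-cong (⟨⟩-comm c τ υ) sep)))
    ]′ (∈-++⁻ (vars τ) (⊆vars over (here refl)))
  where
  open Candidates k x V S

  complete : ∀ τ υ → Positive τ → Positive υ → Linear τ → Linear υ →
             Disjoint (vars τ) (vars υ) → x ∈ vars τ →
             vars (τ ⟨ c ⟩ υ) ⊆ x ∷ V → x ∷ V ⊆ vars (τ ⟨ c ⟩ υ) → Separates S (τ ⟨ c ⟩ υ) →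
             ∃[ χ ] (χ ∈ candidates (suc k) (x ∷ V) S × τ ⟨ c ⟩ υ ≈ χ)
  complete τ υ p q l m τ#υ x∈τ τυ⊆V V⊆τυ sep =
    let τ′ , τ′∈ , τ≈τ′ = candidates-complete k A (restrict c B S) τ A≤k
          (record { positive = p ; linear = l ; vars⊆ = τ⊆A
                  ; ⊆vars = proj₂ ∘ ∈-filter⁻ (_∈? vars τ) {xs = x ∷ V} })
          (separates-restrict c q υ⊆B sep)
        υ′ , υ′∈ , υ≈υ′ = candidates-complete k B (restrict c A S) υ B≤k
          (record { positive = q ; linear = m ; vars⊆ = υ⊆B ; ⊆vars = B⊆υ })
          (separates-restrict c p τ⊆A (separates-cong (⟨⟩-comm c τ υ) sep))
        τυ≈τ′υ′ = ⟨⟩-cong c τ≈τ′ υ≈υ′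
    in τ′ ⟨ c ⟩ υ′
     , ∈-filter⁺ (separates? S)
         (there (∈-compounds c (∈-concatMap⁺ (combine c) (lose
           (∈-filter⁺ (splittable? c S) AB∈splits (splittable c p τ⊆A q υ⊆B sep))
           (∈-cartesianProductWith⁺ (λ υ τ → τ ⟨ c ⟩ υ) υ′∈ τ′∈)))))
         (separates-cong τυ≈τ′υ′ sep)
     , τυ≈τ′υ′
    where
    A B : List Var
    A = filter (_∈? vars τ) (x ∷ V)
    B = filter (_∉? vars τ) (x ∷ V)

    τ⊆A : vars τ ⊆ A
    τ⊆A y∈τ = ∈-filter⁺ (_∈? vars τ) (τυ⊆V (∈-++⁺ˡ y∈τ)) y∈τ

    υ⊆B : vars υ ⊆ B
    υ⊆B y∈υ = ∈-filter⁺ (_∉? vars τ) (τυ⊆V (∈-++⁺ʳ (vars τ) y∈υ)) λ y∈τ → τ#υ (y∈τ , y∈υ)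

    B⊆υ : B ⊆ vars υ
    B⊆υ y∈B with y∈V , y∉τ ← ∈-filter⁻ (_∉? vars τ) {xs = x ∷ V} y∈B =
      [ (λ y∈τ → contradiction y∈τ y∉τ) , id ]′ (∈-++⁻ (vars τ) (V⊆τυ y∈V))

    -- `A` loses a variable of `υ`, and `B` below loses `x`.
    A≤k : length A ≤ k
    A≤k with y , y∈υ ← occurring q = s≤s⁻¹ (≤-trans
      (filter-notAll (_∈? vars τ) (x ∷ V)
        (lose (τυ⊆V (∈-++⁺ʳ (vars τ) y∈υ)) λ y∈τ → τ#υ (y∈τ , y∈υ)))
      V≤k)

    B≤k : length B ≤ k
    B≤k = s≤s⁻¹ (≤-trans
      (filter-notAll (_∉? vars τ) (x ∷ V) (here λ x∉τ → x∉τ x∈τ)) V≤k)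

    AB∈splits : (A , B) ∈ map (Product.map₁ (x ∷_)) (splits V)
    AB∈splits = subst (_∈ map (Product.map₁ (x ∷_)) (splits V))
      (sym (cong₂ _,_ (filter-accept (_∈? vars τ) x∈τ)
                      (filter-reject (_∉? vars τ) λ x∉τ → x∉τ x∈τ)))
      (∈-map⁺ (Product.map₁ (x ∷_)) (filter∈splits (_∈? vars τ) V))

    ∈-compounds : ∀ c {χ} → χ ∈ compounds c → χ ∈ compounds conj ++ compounds disj
    ∈-compounds conj = ∈-++⁺ˡ
    ∈-compounds disj = ∈-++⁺ʳ (compounds conj)

-- Deciding linearity

linear? : ∀ φ → Dec (Linear φ)
linear? ⊤ = yes ⊤
linear? ⊥ = yes ⊥
linear? (var x) = yes (var x)
linear? (neg x) = yes (neg x)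
linear? (φ ⟨ c ⟩ ψ) with linear? φ | linear? ψ | disjoint? (vars φ) (vars ψ)
... | yes l | yes m | yes φ#ψ = yes (bin c l m φ#ψ)
... | no ¬l | _     | _       = no λ { (bin _ l _ _) → ¬l l }
... | _     | no ¬m | _       = no λ { (bin _ _ m _) → ¬m m }
... | _     | _     | no ¬φ#ψ = no λ { (bin _ _ _ φ#ψ) → ¬φ#ψ φ#ψ }

-- Least common connectives

⊑⇒vars⊆ : ∀ {σ φ} → σ ⊑ φ → vars σ ⊆ vars φ
⊑⇒vars⊆ here x∈σ = x∈σ
⊑⇒vars⊆ (left σ⊑φ) x∈σ = ∈-++⁺ˡ (⊑⇒vars⊆ σ⊑φ x∈σ)
⊑⇒vars⊆ (right {φ} σ⊑ψ) x∈σ = ∈-++⁺ʳ (vars φ) (⊑⇒vars⊆ σ⊑ψ x∈σ)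

module _ {c : Connective} {α β : Formula} {x y : Var} (α#β : Disjoint (vars α) (vars β)) where

  -- A proper subformula lies within one operand, so by disjointness it misses `x` or `y`.
  lcc-root : x ∈ vars α → y ∈ vars β → LccIs c x y (α ⟨ c ⟩ β)
  lcc-root x∈α y∈β = α , β , (here , ∈-++⁺ˡ x∈α , ∈-++⁺ʳ (vars α) y∈β) , λ where
    _ (here , _)              → here
    _ (left τ⊑α , _ , y∈τ)    → contradiction (⊑⇒vars⊆ τ⊑α y∈τ , y∈β) α#β
    _ (right τ⊑β , x∈τ , _)   → contradiction (x∈α , ⊑⇒vars⊆ τ⊑β x∈τ) α#β

  lcc-root-unique : ∀ {d} → x ∈ vars α → y ∈ vars β → LccIs d x y (α ⟨ c ⟩ β) → d ≡ c
  lcc-root-unique x∈α y∈β (_ , _ , (here , _) , _) = refl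
  lcc-root-unique x∈α y∈β (_ , _ , (left σ⊑α , _ , y∈σ) , _) =
    contradiction (⊑⇒vars⊆ σ⊑α y∈σ , y∈β) α#β
  lcc-root-unique x∈α y∈β (_ , _ , (right σ⊑β , x∈σ , _) , _) =
    contradiction (x∈α , ⊑⇒vars⊆ σ⊑β x∈σ) α#β

  lcc-left : ∀ {d} → x ∈ vars α → LccIs d x y α → LccIs d x y (α ⟨ c ⟩ β)
  lcc-left x∈α (γ , δ , (σ⊑α , x∈σ , y∈σ) , least) = γ , δ , (left σ⊑α , x∈σ , y∈σ) , λ where
    _ (here , _)                → left σ⊑α
    _ (left τ⊑α , x∈τ , y∈τ)    → least _ (τ⊑α , x∈τ , y∈τ)
    _ (right τ⊑β , x∈τ , _)     → contradiction (x∈α , ⊑⇒vars⊆ τ⊑β x∈τ) α#β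

  -- The variable `z` excludes the root: `α` already contains `x` and `y`, so a smallest common
  -- subformula at the root would have to lie inside `α` and bring `z` with it.
  lcc-left⁻ : ∀ {d z} → x ∈ vars α → y ∈ vars α → z ∈ vars β →
              LccIs d x y (α ⟨ c ⟩ β) → LccIs d x y α
  lcc-left⁻ x∈α y∈α z∈β (_ , _ , (here , _) , least) =
    contradiction (⊑⇒vars⊆ (least α (left here , x∈α , y∈α)) (∈-++⁺ʳ (vars α) z∈β) , z∈β) α#β
  lcc-left⁻ x∈α y∈α z∈β (_ , _ , (left σ⊑α , x∈σ , y∈σ) , least) =
    _ , _ , (σ⊑α , x∈σ , y∈σ) , λ τ (τ⊑α , x∈τ , y∈τ) → least τ (left τ⊑α , x∈τ , y∈τ)
  lcc-left⁻ x∈α y∈α z∈β (_ , _ , (right σ⊑β , x∈σ , _) , _) =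
    contradiction (x∈α , ⊑⇒vars⊆ σ⊑β x∈σ) α#β

-- Satisfaction as products and sums, so that validity of a concrete inference is proved by pattern
-- matching under an arbitrary assignment.
Holds : Assignment → Formula → Set
Holds ρ (φ ⟨ conj ⟩ ψ) = Holds ρ φ × Holds ρ ψ
Holds ρ (φ ⟨ disj ⟩ ψ) = Holds ρ φ ⊎ Holds ρ ψ
Holds ρ φ              = ρ ⊨ φ

⊨⇒Holds : ∀ ρ φ → ρ ⊨ φ → Holds ρ φ
-- `⊥` has no clause because `ρ ⊨ ⊥` is empty.
⊨⇒Holds ρ ⊤       = id
⊨⇒Holds ρ (var x) = id
⊨⇒Holds ρ (neg x) = id
⊨⇒Holds ρ (φ ⟨ conj ⟩ ψ) = Product.map (⊨⇒Holds ρ φ) (⊨⇒Holds ρ ψ) ∘ to T-∧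
⊨⇒Holds ρ (φ ⟨ disj ⟩ ψ) = Sum.map (⊨⇒Holds ρ φ) (⊨⇒Holds ρ ψ) ∘ to T-∨

Holds⇒⊨ : ∀ ρ φ → Holds ρ φ → ρ ⊨ φ
Holds⇒⊨ ρ ⊤       = id
Holds⇒⊨ ρ (var x) = id
Holds⇒⊨ ρ (neg x) = id
Holds⇒⊨ ρ (φ ⟨ conj ⟩ ψ) = from T-∧ ∘ Product.map (Holds⇒⊨ ρ φ) (Holds⇒⊨ ρ ψ)
Holds⇒⊨ ρ (φ ⟨ disj ⟩ ψ) = from T-∨ ∘ Sum.map (Holds⇒⊨ ρ φ) (Holds⇒⊨ ρ ψ)

-- The inference, with w, w′, x, x′, y, y′, z, z′ numbered from 0 to 7

infixr 7 _∧ᶠ_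
infixr 6 _∨ᶠ_

_∧ᶠ_ _∨ᶠ_ : Formula → Formula → Formula
φ ∧ᶠ ψ = φ ⟨ conj ⟩ ψ
φ ∨ᶠ ψ = φ ⟨ disj ⟩ ψ

premise conclusion : Formula
premise    = (var 0 ∧ᶠ var 1 ∨ᶠ var 2 ∧ᶠ var 3) ∧ᶠ (var 4 ∧ᶠ var 5 ∨ᶠ var 6 ∧ᶠ var 7)
conclusion = (var 0 ∧ᶠ var 7 ∨ᶠ var 3) ∧ᶠ (var 2 ∧ᶠ var 5 ∨ᶠ var 6) ∨ᶠ var 1 ∧ᶠ var 4

only : List Var → Assignment
only V x = does (x ∈? V)

-- The minterms of the premise and the maxterms of the conclusion.
interpolantSample : Sample
interpolantSample = sample
  (map only ( (0 ∷ 1 ∷ 4 ∷ 5 ∷ []) ∷ (0 ∷ 1 ∷ 6 ∷ 7 ∷ [])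
            ∷ (2 ∷ 3 ∷ 4 ∷ 5 ∷ []) ∷ (2 ∷ 3 ∷ 6 ∷ 7 ∷ []) ∷ []))
  (map (λ V → not ∘ only V)
    -- Falsifying the conclusion takes one of `w′`, `y` together with a pair falsifying
    -- `(w ∧ z′) ∨ x′` or `(x ∧ y′) ∨ z`.
    (cartesianProductWith _∷_ (1 ∷ 4 ∷ [])
      ((0 ∷ 3 ∷ []) ∷ (7 ∷ 3 ∷ []) ∷ (2 ∷ 6 ∷ []) ∷ (5 ∷ 6 ∷ []) ∷ [])))

-- The search is run by evaluation, with fuel 8 for eight variables. The equality is literal because
-- both formulae are written as the search builds them, with the first variable of each list on the
-- left. Connectives alternate along every branch of both, so neither reappears rebracketed.
candidates-interpolantSample :
  candidates 8 (vars premise) interpolantSample ≡ premise ∷ conclusion ∷ []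
candidates-interpolantSample = refl

interpolant-separates : ∀ φ ψ χ {S} →
  All (λ ρ → eval ρ φ ≡ true) (positives S) → All (λ ρ → eval ρ ψ ≡ false) (negatives S) →
  φ ⇛ χ → χ ⇛ ψ → Separates S χ
interpolant-separates φ ψ χ φ-true ψ-false φ⇛χ χ⇛ψ = separating
  (All.map (λ {ρ} eq → to T-≡ (φ⇛χ ρ (from T-≡ eq))) φ-true)
  (All.map (λ {ρ} eq → ¬-not λ χ-true →
    Bool.not-¬ (to T-≡ (χ⇛ψ ρ (from T-≡ χ-true))) eq) ψ-false)

premise⇛conclusion : premise ⇛ conclusion
premise⇛conclusion ρ ρ⊨premise =
  Holds⇒⊨ ρ conclusion (valid (⊨⇒Holds ρ premise ρ⊨premise))
  where
  valid : Holds ρ premise → Holds ρ conclusion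
  valid (inj₁ (_ , w′) , inj₁ (y , _))  = inj₂ (w′ , y)
  valid (inj₁ (w , _)  , inj₂ (z , z′)) = inj₁ (inj₁ (w , z′) , inj₂ z)
  valid (inj₂ (x , x′) , inj₁ (_ , y′)) = inj₁ (inj₂ x′ , inj₁ (x , y′))
  valid (inj₂ (_ , x′) , inj₂ (z , _))  = inj₁ (inj₂ x′ , inj₂ z)

-- Non-triviality and logical minimality of the witness

vars-conclusion⊆vars-premise : vars conclusion ⊆ vars premise
vars-conclusion⊆vars-premise =
  All.lookup (from-yes (all? (_∈? vars premise) (vars conclusion)))

not-trivial-at : ∀ {x} → x ∈ vars premise → ¬ TrivialAt x premise conclusion
not-trivial-at {x} x∈ trivial =
  let ρ , ρ⊨premise , ρ⊭conclusion = satisfied (All.lookup witnesses x∈) in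
  ρ⊭conclusion (trivial ρ ρ⊨premise)
  where
  -- For each variable, the counterexample to triviality is found among the minterms of the premise.
  witnesses : All (λ x → Any (λ ρ → ρ ⊨ premise [ true / x ] × ¬ (ρ ⊨ conclusion [ false / x ]))
                             (positives interpolantSample))
                  (vars premise)
  witnesses = from-yes (all? (λ x → any? (λ ρ → T? (eval ρ (premise [ true / x ])) ×-dec
                                                ¬? (T? (eval ρ (conclusion [ false / x ]))))
                                          (positives interpolantSample))
                             (vars premise))

logically-minimal : LogicallyMinimal premise conclusion
logically-minimal χ premise→χ χ→conclusion
  with τ , over , χ≈τ ← interpolant-tree (vars premise) premise conclusion χ (here refl) id
         vars-conclusion⊆vars-premise not-trivial-at
         (LinearInference.linearʳ premise→χ)
         (LinearInference.valid premise→χ) (LinearInference.valid χ→conclusion)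
  with υ , υ∈ , τ≈υ ← candidates-complete 8 (vars premise) interpolantSample τ ≤-refl over
         (separates-cong {τ = χ} {τ} χ≈τ (interpolant-separates premise conclusion χ
           (from-yes (all? (λ ρ → eval ρ premise Bool.≟ true) (positives interpolantSample)))
           (from-yes (all? (λ ρ → eval ρ conclusion Bool.≟ false) (negatives interpolantSample)))
           (LinearInference.valid premise→χ) (LinearInference.valid χ→conclusion)))
  with subst (υ ∈_) candidates-interpolantSample υ∈
... | here refl         = inj₁ (≈⇒≋ χ premise λ ρ → trans (χ≈τ ρ) (τ≈υ ρ))
... | there (here refl) = inj₂ (≈⇒≋ χ conclusion λ ρ → trans (χ≈τ ρ) (τ≈υ ρ))

-- Linearity and least common connectives of the witness

disjoint-operands : ∀ {φ c ψ} → Linear (φ ⟨ c ⟩ ψ) → Disjoint (vars φ) (vars ψ)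
disjoint-operands (bin _ _ _ φ#ψ) = φ#ψ

linear-left : ∀ {φ c ψ} → Linear (φ ⟨ c ⟩ ψ) → Linear φ
linear-left (bin _ l _ _) = l

linear-premise : Linear premise
linear-premise = from-yes (linear? premise)

linear-conclusion : Linear conclusion
linear-conclusion = from-yes (linear? conclusion)

¬preserves-conj : ¬ PreservesLccs conj premise conclusion
¬preserves-conj preserves
  with () ← lcc-root-unique (disjoint-operands linear-conclusion) (here refl) (there (here refl))
              (preserves 0 4 (λ ())
                (lcc-root (disjoint-operands linear-premise) (here refl) (here refl)))

¬preserves-disj : ¬ PreservesLccs disj premise conclusion
¬preserves-disj preserves
  with () ← lcc-root-unique (disjoint-operands (linear-left linear-conclusion)) (here refl) (here refl)
              -- Both `w` and `x` lie in the left operand of the conclusion; `w′`, in the right one,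
              -- rules out the root.
              (lcc-left⁻ (disjoint-operands linear-conclusion)
                (here refl) (there (there (there (here refl)))) (here refl)
                (preserves 0 2 (λ ())
                  (lcc-left (disjoint-operands linear-premise) (here refl)
                    (lcc-root (disjoint-operands (linear-left linear-premise))
                      (here refl) (here refl)))))

theorem3p5 : ∃[ φ ] ∃[ ψ ]
    ( LinearInference φ ψ
    × LogicallyMinimal φ ψ
    × NonTrivial φ ψ
    × ¬ PreservesLccs conj φ ψ
    × ¬ PreservesLccs disj φ ψ )
theorem3p5 = premise , conclusion
  , record { linearˡ = linear-premise ; linearʳ = linear-conclusion ; valid = premise⇛conclusion }
  , logically-minimal
  , (λ (_ , x∈ , trivial) →
      not-trivial-at ([ id , vars-conclusion⊆vars-premise ]′ x∈) trivial)
  , ¬preserves-conj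
  , ¬preserves-disj
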